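{- Let $(S,+)$ be a semigroup with no idempotent element and of cardinality $\kappa>\omega$. Let $\mu$ be a cardinal with $\omega<\mu\le\kappa$ such that there is a family of $\lambda$ almost disjoint subsets of $\mu$, and let $A\subseteq S$ be an IP set with $|A|=\mu$. Then $A$ contains a family of $\lambda$ almost disjoint subsets each of which is an IP set.
   Context: For an infinite set $X$, a family $\mathcal{A}$ is a family of almost disjoint subsets of $X$ if each $B\in\mathcal{A}$ satisfies $B\subseteq X$ and $|B|=|X|$, and for distinct $B,C\in\mathcal{A}$, $|B\cap C|<|X|$. $e$ is idempotent if $e+e=e$. $A\subseteq S$ is an IP set if there is a sequence $\langle x_n\rangle_{n=1}^\infty$ in $S$ with all finite sums $\sum_{n\in H}x_n$ (increasing order, $H$ a nonempty finite subset of $\mathbb{N}$) in $A$. -}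

module Defs where

open import Level using (Level; _⊔_; suc)
open import Algebra.Bundles using (Semigroup)
open import Algebra.Definitions using (_IdempotentOn_)
open import Data.List.NonEmpty using (List⁺; foldr₁; map; toList)
open import Data.List.Relation.Unary.Linked using (Linked)
open import Data.Nat.Base using (ℕ; _<_)
open import Data.Product.Base using (Σ; ∃; _×_; _,_; proj₁)
open import Data.Unit.Polymorphic.Base using (⊤)
open import Function.Bundles using (Injection; Bijection)
open import Relation.Binary.Bundles using (Setoid)
open import Relation.Binary.Definitions using (_Respects_)
import Relation.Binary.Construct.On as On
import Relation.Binary.PropositionalEquality.Properties as ≡
open import Relation.Nullary using (¬_)
import Relation.Unary as Unary
open import Relation.Unary.Relation.Binary.Equality using (≐-setoid)

-- Sets are setoids, and a cardinal is given by any set of that size: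
-- below, κ, μ and Λ are setoids that stand for their own cardinality, and
-- cardinals are compared through setoid maps.

infix 4 _≲_ _≅_ _≺_

_≲_ : {a b c d : Level} → Setoid a b → Setoid c d → Set (a ⊔ b ⊔ c ⊔ d)
X ≲ Y = Injection X Y

_≅_ : {a b c d : Level} → Setoid a b → Setoid c d → Set (a ⊔ b ⊔ c ⊔ d)
X ≅ Y = Bijection X Y

_≺_ : {a b c d : Level} → Setoid a b → Setoid c d → Set (a ⊔ b ⊔ c ⊔ d)
X ≺ Y = X ≲ Y × ¬ (X ≅ Y)

ω : Setoid Level.zero Level.zero
ω = ≡.setoid ℕ

record Subset {a : Level} (X : Setoid a a) : Set (suc a) where
  open Setoid X
  field
    pred     : Unary.Pred Carrier a
    respects : pred Respects _≈_

open Subset public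

module _ {a : Level} {X : Setoid a a} where

  open Setoid X

  infix  4 _∈_ _⊆_
  infixr 7 _∩_

  _∈_ : Carrier → Subset X → Set a
  x ∈ B = pred B x

  _⊆_ : Subset X → Subset X → Set a
  B ⊆ C = pred B Unary.⊆ pred C

  _∩_ : Subset X → Subset X → Subset X
  B ∩ C = record
    { pred     = pred B Unary.∩ pred C
    ; respects = λ x≈y (x∈B , x∈C) → respects B x≈y x∈B , respects C x≈y x∈C
    }

  -- Membership proofs are ignored by the equality, so ⟦ B ⟧ has the
  -- cardinality of B.
  ⟦_⟧ : Subset X → Setoid a a
  ⟦ B ⟧ = On.setoid {B = Σ Carrier (pred B)} X proj₁

full : {a : Level} (X : Setoid a a) → Subset X
full X = record { pred = λ _ → ⊤ ; respects = λ _ _ → _ }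

-- The power set: subsets are equal when they have the same elements.
𝒫 : {a : Level} → Setoid a a → Setoid (suc a) a
𝒫 {a} X = On.setoid {B = Subset X} (≐-setoid (Setoid.Carrier X) a) pred

-- A family of Λ almost disjoint subsets of Y, where Y is itself a subset of
-- an ambient set X. The injectivity of `family` says that it has exactly Λ
-- members.
record AlmostDisjointFamily {a : Level} {X : Setoid a a}
                            (Λ : Setoid a a) (Y : Subset X) : Set (suc a) where
  field
    family : Injection Λ (𝒫 X)

  member : Setoid.Carrier Λ → Subset X
  member = Injection.to family

  field
    contained      : ∀ i → member i ⊆ Y
    sameSize       : ∀ i → ⟦ member i ⟧ ≅ ⟦ Y ⟧
    almostDisjoint : ∀ i j → ¬ (Setoid._≈_ (𝒫 X) (member i) (member j)) →
                     ⟦ member i ∩ member j ⟧ ≺ ⟦ Y ⟧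

module _ {a : Level} (S : Semigroup a a) where

  open Semigroup S

  HasIdempotent : Set a
  HasIdempotent = ∃ λ e → _IdempotentOn_ _≈_ _∙_ e

  -- A nonempty finite H ⊆ ℕ is a strictly increasing nonempty list, and the
  -- sum is taken in that order. Sequences are indexed from 0.
  IsIP : Subset setoid → Set a
  IsIP A = ∃ λ (x : ℕ → Carrier) →
    (H : List⁺ ℕ) → Linked _<_ (toList H) → foldr₁ _∙_ (map x H) ∈ A

{-# OPTIONS --safe #-}

-- The set D of all finite sums of the sequence witnessing that A is an IP set
-- is a countable subset of A. Transport the almost disjoint sets Bᵢ from μ to
-- A and replace each of them by its union with D. The unions are IP sets and
-- have size μ by Cantor–Schröder–Bernstein. The intersection of two of them
-- is (Bᵢ ∩ Bⱼ) ∪ D up to transport; if it had size μ, it would be uncountable,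
-- so Bᵢ ∩ Bⱼ would be infinite, hence would absorb D and have size μ itself.
module Submission where

open import Defs
open import Algebra.Bundles using (Semigroup)
open import Axiom.ExcludedMiddle using (ExcludedMiddle)
open import Data.Empty using (⊥-elim)
open import Data.Fin.Base using (toℕ)
open import Data.Fin.Properties using (toℕ-injective)
open import Data.List.Base using (List; []; _∷_)
open import Data.List.NonEmpty using (List⁺; foldr₁; map; toList) renaming (_∷_ to _∷⁺_)
import Data.List.Membership.Setoid as Membership
import Data.List.Membership.Setoid.Properties as Membershipₚ
open import Data.List.Relation.Unary.Any using (here; there; index)
open import Data.List.Relation.Unary.Linked using (Linked)
open import Data.Nat.Base as ℕ using (ℕ; zero; suc; _≤_; _<_; _<′_; ≤′-reflexive; ≤′-step; z≤n; s≤s)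
open import Data.Nat.Binary.Base as ℕᵇ using (ℕᵇ; 2[1+_]; 1+[2_])
import Data.Nat.Binary.Properties as ℕᵇ
open import Data.Nat.Properties
  using (≤-antisym; <⇒<′; <-cmp; even≢odd; *-cancelˡ-≡; suc-injective)
open import Data.Product.Base using (Σ; ∃; _×_; _,_; proj₁; proj₂; map₁; map₂)
open import Data.Sum.Base as Sum using (_⊎_; inj₁; inj₂; [_,_]′)
open import Data.Sum.Function.Setoid using (_⊎-injection_)
open import Data.Sum.Relation.Binary.Pointwise using (_⊎ₛ_; inj₁; inj₂)
open import Function.Base using (_∘_; id)
open import Function.Bundles using (Injection; Bijection; Inverse)
open import Function.Properties.Bijection using (Bijection⇒Inverse)
import Function.Properties.Injection as ≲
open import Level using (Level; _⊔_; lift; lower)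
open import Relation.Binary.Bundles using (Setoid)
open import Relation.Binary.Definitions using (tri<; tri≈; tri>)
open import Relation.Binary.PropositionalEquality as ≡ using (_≡_)
open import Relation.Nullary using (¬_; yes; no; contradiction)
open import Relation.Nullary.Decidable using (decidable-stable; map′)

private
  variable
    a c d ℓ ℓ′ : Level

-- Injections in both directions from a bijection

≅⇒≲ : {X : Setoid c ℓ} {Y : Setoid d ℓ′} → X ≅ Y → X ≲ Y
≅⇒≲ = Bijection.injection

≅⇒≳ : {X : Setoid c ℓ} {Y : Setoid d ℓ′} → X ≅ Y → Y ≲ X
≅⇒≳ {X = X} {Y = Y} X≅Y = record
  { to        = from
  ; cong      = from-cong
  ; injective = λ {x} {y} eq → Setoid.trans Y (Setoid.sym Y (strictlyInverseˡ x))
                  (Setoid.trans Y (to-cong eq) (strictlyInverseˡ y))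
  }
  where open Inverse (Bijection⇒Inverse X≅Y)

-- Cantor–Schröder–Bernstein

module _ (X : Setoid c ℓ) (Y : Setoid d ℓ′) (f : X ≲ Y) (g : Y ≲ X) where

  private
    module X = Setoid X
    module Y = Setoid Y
    module f = Injection f
    module g = Injection g

  -- The points of X whose backward orbit stops in X, outside the image of g.
  data Rooted : X.Carrier → Set (c ⊔ d ⊔ ℓ ⊔ ℓ′) where
    root : ∀ {x} → ¬ (∃ λ y → g.to y X.≈ x) → Rooted x
    step : ∀ {x x′} → Rooted x → g.to (f.to x) X.≈ x′ → Rooted x′

  Rooted-resp : ∀ {x x′} → x X.≈ x′ → Rooted x → Rooted x′
  Rooted-resp x≈x′ (root ¬y)   = root (¬y ∘ map₂ (λ e → X.trans e (X.sym x≈x′)))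
  Rooted-resp x≈x′ (step r eq) = step r (X.trans eq x≈x′)

  -- A value of `g` is not a root, so its derivation ends in a `step`, and injectivity of `g`
  -- cancels the last `g`.
  Rooted-g⁻¹ : ∀ {y} → Rooted (g.to y) → ∃ λ x → Rooted x × f.to x Y.≈ y
  Rooted-g⁻¹ (root ¬y)   = contradiction (_ , X.refl) ¬y
  Rooted-g⁻¹ (step r eq) = _ , r , g.injective eq

  private
    -- The bijection follows `f` on rooted points and the inverse of `g` elsewhere. As a relation,
    -- it can be analysed without unfolding the choices made by excluded middle.
    Graph : X.Carrier → Y.Carrier → Set (c ⊔ d ⊔ ℓ ⊔ ℓ′)
    Graph x y = (Rooted x × f.to x Y.≈ y) ⊎ (¬ Rooted x × g.to y X.≈ x)

    Graph-functional : ∀ {x x′ y y′} → x X.≈ x′ → Graph x y → Graph x′ y′ → y Y.≈ y′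
    Graph-functional x≈x′ (inj₁ (_ , fx≈y)) (inj₁ (_ , fx′≈y′)) =
      Y.trans (Y.sym fx≈y) (Y.trans (f.cong x≈x′) fx′≈y′)
    Graph-functional x≈x′ (inj₁ (r , _)) (inj₂ (¬r , _)) =
      contradiction (Rooted-resp x≈x′ r) ¬r
    Graph-functional x≈x′ (inj₂ (¬r , _)) (inj₁ (r , _)) =
      contradiction (Rooted-resp (X.sym x≈x′) r) ¬r
    Graph-functional x≈x′ (inj₂ (_ , gy≈x)) (inj₂ (_ , gy′≈x′)) =
      g.injective (X.trans gy≈x (X.trans x≈x′ (X.sym gy′≈x′)))

    -- In the mixed cases one point is `g` of `f` of a rooted point, hence rooted itself.
    Graph-injective : ∀ {x x′ y y′} → y Y.≈ y′ → Graph x y → Graph x′ y′ → x X.≈ x′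
    Graph-injective y≈y′ (inj₁ (_ , fx≈y)) (inj₁ (_ , fx′≈y′)) =
      f.injective (Y.trans fx≈y (Y.trans y≈y′ (Y.sym fx′≈y′)))
    Graph-injective y≈y′ (inj₁ (r , fx≈y)) (inj₂ (¬r , gy′≈x′)) =
      contradiction (step r (X.trans (g.cong (Y.trans fx≈y y≈y′)) gy′≈x′)) ¬r
    Graph-injective y≈y′ (inj₂ (¬r , gy≈x)) (inj₁ (r , fx′≈y′)) =
      contradiction (step r (X.trans (g.cong (Y.trans fx′≈y′ (Y.sym y≈y′))) gy≈x)) ¬r
    Graph-injective y≈y′ (inj₂ (_ , gy≈x)) (inj₂ (_ , gy′≈x′)) =
      X.trans (X.sym gy≈x) (X.trans (g.cong y≈y′) gy′≈x′)

  module _ (em : ExcludedMiddle (c ⊔ d ⊔ ℓ ⊔ ℓ′)) where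

    private
      total : ∀ x → ∃ (Graph x)
      -- Without a value, `x` is not rooted, as `f.to x` would do; so it is not in the image of `g`
      -- either, as a preimage would do. But then it is a root.
      total x = decidable-stable em λ ¬G →
        let ¬rooted = λ r → ¬G (f.to x , inj₁ (r , Y.refl))
        in ¬rooted (root λ (y , gy≈x) → ¬G (y , inj₂ (¬rooted , gy≈x)))

      onto : ∀ y → ∃ λ x → Graph x y
      onto y with em {Rooted (g.to y)}
      ... | yes r = map₂ inj₁ (Rooted-g⁻¹ r)
      ... | no ¬r = g.to y , inj₂ (¬r , X.refl)

    ≲-antisym : X ≅ Y
    ≲-antisym = record
      { to        = proj₁ ∘ total
      ; cong      = λ x≈x′ → Graph-functional x≈x′ (proj₂ (total _)) (proj₂ (total _))
      ; bijective = (λ y≈y′ → Graph-injective y≈y′ (proj₂ (total _)) (proj₂ (total _)))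
                  , λ y → map₂ (λ G z≈x → Graph-functional z≈x (proj₂ (total _)) G) (onto y)
      }

-- Countable setoids

Least : (ℕ → Set ℓ) → ℕ → Set ℓ
Least P m = P m × ∀ k → P k → m ≤ k

-- Induction on the witness: if `P` fails at 0, the shifted predicate has a smaller witness.
least : ExcludedMiddle ℓ → (P : ℕ → Set ℓ) → ∀ n → P n → ∃ (Least P)
least em P zero    p = 0 , p , λ _ _ → z≤n
least em P (suc n) p with em {P 0}
... | yes p₀ = 0 , p₀ , λ _ _ → z≤n
... | no ¬p₀ with least em (P ∘ suc) n p
...   | m , q , m-min = suc m , q , λ where
  zero    p₀ → contradiction p₀ ¬p₀
  (suc k) r  → s≤s (m-min k r)

module _ (em : ExcludedMiddle (c ⊔ ℓ)) (X : Setoid c ℓ) where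

  open Setoid X
  open Membership X using (_∉_) renaming (_∈_ to _∈ₗ_)

  -- The code need not respect the equality of X: send each point to the least
  -- code of its equivalence class.
  reflecting⇒≲ω : (code : Carrier → ℕ) → (∀ x y → code x ≡ code y → x ≈ y) → X ≲ ω
  reflecting⇒≲ω code reflect = record
    { to        = λ x → proj₁ (min x)
    ; cong      = λ {x} {y} x≈y → ≤-antisym
        (proj₂ (proj₂ (min x)) _ (IsCode-resp (sym x≈y) (proj₁ (proj₂ (min y)))))
        (proj₂ (proj₂ (min y)) _ (IsCode-resp x≈y (proj₁ (proj₂ (min x)))))
    ; injective = λ {x} {y} eq → IsCode-reflect eq (proj₁ (proj₂ (min x))) (proj₁ (proj₂ (min y)))
    }
    where
    IsCode : Carrier → ℕ → Set (c ⊔ ℓ)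
    IsCode x n = ∃ λ y → y ≈ x × code y ≡ n

    min : ∀ x → ∃ (Least (IsCode x))
    min x = least em (IsCode x) (code x) (x , refl , ≡.refl)

    IsCode-resp : ∀ {x x′ n} → x ≈ x′ → IsCode x n → IsCode x′ n
    IsCode-resp x≈x′ (y , y≈x , eq) = y , trans y≈x x≈x′ , eq

    IsCode-reflect : ∀ {x x′ n n′} → n ≡ n′ → IsCode x n → IsCode x′ n′ → x ≈ x′
    IsCode-reflect n≡n′ (y , y≈x , eq) (y′ , y′≈x′ , eq′) =
      trans (sym y≈x) (trans (reflect _ _ (≡.trans eq (≡.trans n≡n′ (≡.sym eq′)))) y′≈x′)

  -- The code is a position in `xs`. Equal points may be found at different positions if `xs` has
  -- repetitions, but a common position forces equality.
  exhausted⇒≲ω : (xs : List Carrier) → (∀ x → x ∈ₗ xs) → X ≲ ω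
  exhausted⇒≲ω xs all = reflecting⇒≲ω (toℕ ∘ index ∘ all)
    (λ x y → Membershipₚ.index-injective X (all x) (all y) ∘ toℕ-injective)

  -- No finite list exhausts `X`, so points can be picked one after another, each outside the list
  -- of its predecessors.
  uncountable⇒ω≲ : ¬ (X ≲ ω) → ω ≲ X
  uncountable⇒ω≲ X≴ω = record
    { to        = next
    ; cong      = λ { ≡.refl → refl }
    ; injective = next-injective
    }
    where
    fresh : ∀ xs → ∃ (_∉ xs)
    fresh xs = decidable-stable em λ ¬x →
      X≴ω (exhausted⇒≲ω xs λ x → decidable-stable em λ x∉xs → ¬x (x , x∉xs))

    -- `chosen n` holds `next 0` up to `next (n - 1)`, the points that `next n` must avoid.
    chosen : ℕ → List Carrier
    next   : ℕ → Carrier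

    chosen zero    = []
    chosen (suc n) = next n ∷ chosen n
    next n         = proj₁ (fresh (chosen n))

    next∈chosen : ∀ {m n} → m <′ n → next m ∈ₗ chosen n
    next∈chosen (≤′-reflexive ≡.refl) = here refl
    next∈chosen (≤′-step m<n)         = there (next∈chosen m<n)

    next-distinct : ∀ {m n} → m < n → ¬ (next m ≈ next n)
    next-distinct {n = n} m<n eq = proj₂ (fresh (chosen n))
      (Membershipₚ.∈-resp-≈ X eq (next∈chosen (<⇒<′ m<n)))

    next-injective : ∀ {m n} → next m ≈ next n → m ≡ n
    next-injective {m} {n} eq with <-cmp m n
    ... | tri< m<n _ _ = contradiction eq (next-distinct m<n)
    ... | tri≈ _ m≡n _ = m≡n
    ... | tri> _ _ n<m = contradiction (sym eq) (next-distinct n<m)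

  -- Hilbert's hotel: the given copy of ω in X moves to its even places, and
  -- the new copy occupies the odd ones.
  ω-absorbed : ω ≲ X → (X ⊎ₛ ω) ≲ X
  ω-absorbed h = record
    { to        = [ proj₁ ∘ move , odd ]′
    ; cong      = λ where
        (inj₁ x≈y)    → move-cong x≈y (proj₂ (move _)) (proj₂ (move _))
        (inj₂ ≡.refl) → refl
    ; injective = injective
    }
    where
    module h = Injection h

    even odd : ℕ → Carrier
    even n = h.to (2 ℕ.* n)
    odd  n = h.to (suc (2 ℕ.* n))

    -- Points in the range of `h` double their index, all others stay. A relation again keeps the
    -- case distinction independent of excluded middle.
    Moved : Carrier → Carrier → Set ℓ
    Moved x y = (∃ λ n → h.to n ≈ x × even n ≈ y) ⊎ (¬ (∃ λ n → h.to n ≈ x) × x ≈ y)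

    move : ∀ x → ∃ (Moved x)
    move x = decidable-stable em λ ¬m →
      ¬m (x , inj₂ ((λ (n , hn≈x) → ¬m (even n , inj₁ (n , hn≈x , refl))) , refl))

    move-cong : ∀ {x x′ y y′} → x ≈ x′ → Moved x y → Moved x′ y′ → y ≈ y′
    move-cong x≈x′ (inj₁ (m , hm≈x , e)) (inj₁ (n , hn≈x′ , e′))
      with h.injective (trans hm≈x (trans x≈x′ (sym hn≈x′)))
    ... | ≡.refl = trans (sym e) e′
    move-cong x≈x′ (inj₁ (m , hm≈x , _)) (inj₂ (¬n , _)) = contradiction (m , trans hm≈x x≈x′) ¬n
    move-cong x≈x′ (inj₂ (¬m , _)) (inj₁ (n , hn≈x′ , _)) =
      contradiction (n , trans hn≈x′ (sym x≈x′)) ¬m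
    move-cong x≈x′ (inj₂ (_ , e)) (inj₂ (_ , e′)) = trans (sym e) (trans x≈x′ e′)

    move-injective : ∀ {x x′ y y′} → y ≈ y′ → Moved x y → Moved x′ y′ → x ≈ x′
    move-injective y≈y′ (inj₁ (m , hm≈x , e)) (inj₁ (n , hn≈x′ , e′))
      with *-cancelˡ-≡ m n 2 (h.injective (trans e (trans y≈y′ (sym e′))))
    ... | ≡.refl = trans (sym hm≈x) hn≈x′
    move-injective y≈y′ (inj₁ (m , _ , e)) (inj₂ (¬n , e′)) =
      contradiction (2 ℕ.* m , trans e (trans y≈y′ (sym e′))) ¬n
    move-injective y≈y′ (inj₂ (¬m , e)) (inj₁ (n , _ , e′)) =
      contradiction (2 ℕ.* n , trans e′ (trans (sym y≈y′) (sym e))) ¬m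
    move-injective y≈y′ (inj₂ (_ , e)) (inj₂ (_ , e′)) = trans e (trans y≈y′ (sym e′))

    -- A moved point is either `h` at an even index or outside the range of `h`.
    odd∉move : ∀ n {x y} → Moved x y → ¬ (odd n ≈ y)
    odd∉move n (inj₁ (m , _ , e)) o = even≢odd m n (h.injective (trans e (sym o)))
    odd∉move n (inj₂ (¬m , e))        o = ¬m (_ , trans o (sym e))

    injective : ∀ {u v} → [ proj₁ ∘ move , odd ]′ u ≈ [ proj₁ ∘ move , odd ]′ v →
                Setoid._≈_ (X ⊎ₛ ω) u v
    injective {inj₁ x} {inj₁ y} eq = inj₁ (move-injective eq (proj₂ (move x)) (proj₂ (move y)))
    injective {inj₁ x} {inj₂ n} eq = ⊥-elim (odd∉move n (proj₂ (move x)) (sym eq))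
    injective {inj₂ m} {inj₁ y} eq = ⊥-elim (odd∉move m (proj₂ (move y)) eq)
    injective {inj₂ m} {inj₂ n} eq = inj₂ (*-cancelˡ-≡ m n 2 (suc-injective (h.injective eq)))

-- Coding lists of natural numbers

-- In bijective base 2, least significant digit first, pairᵇ m b consists of m
-- digits 2, a digit 1 and the digits of b, so both arguments can be read off.
pairᵇ : ℕ → ℕᵇ → ℕᵇ
pairᵇ zero    b = 1+[2 b ]
pairᵇ (suc m) b = 2[1+ pairᵇ m b ]

pairᵇ-injective : ∀ m n {b c} → pairᵇ m b ≡ pairᵇ n c → m ≡ n × b ≡ c
pairᵇ-injective zero    zero    ≡.refl = ≡.refl , ≡.refl
pairᵇ-injective (suc m) (suc n) eq     = map₁ (≡.cong suc) (pairᵇ-injective m n (ℕᵇ.2[1+_]-injective eq))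

pairᵇ≢zero : ∀ m {b} → ¬ (pairᵇ m b ≡ ℕᵇ.zero)
pairᵇ≢zero zero    ()
pairᵇ≢zero (suc m) ()

listᵇ : List ℕ → ℕᵇ
listᵇ []       = ℕᵇ.zero
listᵇ (n ∷ ns) = pairᵇ n (listᵇ ns)

-- Only the empty list has code zero, so the end of a list is recognised as well as its entries.
listᵇ-injective : ∀ ms ns → listᵇ ms ≡ listᵇ ns → ms ≡ ns
listᵇ-injective []       []       _  = ≡.refl
listᵇ-injective []       (n ∷ ns) eq = contradiction (≡.sym eq) (pairᵇ≢zero n)
listᵇ-injective (m ∷ ms) []       eq = contradiction eq (pairᵇ≢zero m)
listᵇ-injective (m ∷ ms) (n ∷ ns) eq with pairᵇ-injective m n eq
... | m≡n , eq′ = ≡.cong₂ _∷_ m≡n (listᵇ-injective ms ns eq′)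

toList-injective : ∀ {A : Set c} {xs ys : List⁺ A} → toList xs ≡ toList ys → xs ≡ ys
toList-injective {xs = x ∷⁺ xs} {ys = .x ∷⁺ .xs} ≡.refl = ≡.refl

-- Subsets

module _ {X : Setoid a a} where

  open Setoid X

  infixr 6 _∪_

  _∪_ : Subset X → Subset X → Subset X
  B ∪ C = record
    { pred     = λ x → x ∈ B ⊎ x ∈ C
    ; respects = λ x≈y → Sum.map (respects B x≈y) (respects C x≈y)
    }

  ⊆⇒≲ : (B C : Subset X) → B ⊆ C → ⟦ B ⟧ ≲ ⟦ C ⟧
  ⊆⇒≲ _ _ B⊆C = record { to = map₂ B⊆C ; cong = id ; injective = id }

  ⟦⟧≲ : (B : Subset X) → ⟦ B ⟧ ≲ X
  ⟦⟧≲ B = record { to = proj₁ ; cong = id ; injective = id }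

  ≲full : X ≲ ⟦ full X ⟧
  ≲full = record { to = _, _ ; cong = id ; injective = id }

  module _ (em : ExcludedMiddle a) (B C : Subset X) where

    -- Common points go to the left summand. The side is decided by membership in `B`, not by the
    -- given proof of membership in the union, so equal points land on the same side.
    ∪≲⊎ : ⟦ B ∪ C ⟧ ≲ (⟦ B ⟧ ⊎ₛ ⟦ C ⟧)
    ∪≲⊎ = record
      { to        = to
      ; cong      = λ {u} {v} → to-cong u v
      ; injective = λ {u} {v} → to-injective u v
      }
      where
      to : Setoid.Carrier ⟦ B ∪ C ⟧ → Setoid.Carrier (⟦ B ⟧ ⊎ₛ ⟦ C ⟧)
      to (x , x∈B∪C) with em {x ∈ B}
      ... | yes x∈B = inj₁ (x , x∈B)
      ... | no  x∉B = inj₂ (x , [ (λ x∈B → contradiction x∈B x∉B) , id ]′ x∈B∪C)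

      to-cong : ∀ u v → proj₁ u ≈ proj₁ v → Setoid._≈_ (⟦ B ⟧ ⊎ₛ ⟦ C ⟧) (to u) (to v)
      to-cong (x , _) (y , _) x≈y with em {x ∈ B} | em {y ∈ B}
      ... | yes _   | yes _   = inj₁ x≈y
      ... | yes x∈B | no  y∉B = contradiction (respects B x≈y x∈B) y∉B
      ... | no  x∉B | yes y∈B = contradiction (respects B (sym x≈y) y∈B) x∉B
      ... | no  _   | no  _   = inj₂ x≈y

      to-injective : ∀ u v → Setoid._≈_ (⟦ B ⟧ ⊎ₛ ⟦ C ⟧) (to u) (to v) → proj₁ u ≈ proj₁ v
      to-injective (x , _) (y , _) eq with em {x ∈ B} | em {y ∈ B} | eq
      ... | yes _ | yes _ | inj₁ x≈y = x≈y
      ... | no  _ | no  _ | inj₂ x≈y = x≈y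

    ∪-absorb : ω ≲ ⟦ B ⟧ → ⟦ C ⟧ ≲ ω → ⟦ B ∪ C ⟧ ≲ ⟦ B ⟧
    ∪-absorb ω≲B C≲ω =
      ≲.trans ∪≲⊎ (≲.trans (≲.refl ⊎-injection C≲ω) (ω-absorbed em ⟦ B ⟧ ω≲B))

    ∪-countable : ⟦ B ⟧ ≲ ω → ⟦ C ⟧ ≲ ω → ⟦ B ∪ C ⟧ ≲ ω
    ∪-countable B≲ω C≲ω = ≲.trans ∪≲⊎ (≲.trans (B≲ω ⊎-injection C≲ω)
      -- `ω` lives at level zero; excluded middle there comes from level `a` by lifting
      -- propositions.
      (ω-absorbed (map′ lower (lift {ℓ = a}) em) ω ≲.refl))

-- Transport of subsets along a bijection

module _ {X Y : Setoid a a} (A : Subset X) (A≅Y : ⟦ A ⟧ ≅ Y) where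

  private
    module Y = Setoid Y
    open Bijection A≅Y using (to; cong; injective)
    module from = Injection (≅⇒≳ A≅Y)

  pullback : Subset Y → Subset X
  pullback B = record
    { pred     = λ x → Σ (x ∈ A) λ x∈A → to (x , x∈A) ∈ B
    ; respects = λ x≈y (x∈A , fx∈B) → respects A x≈y x∈A , respects B (cong x≈y) fx∈B
    }

  ≲pullback : (B : Subset Y) → ⟦ B ⟧ ≲ ⟦ pullback B ⟧
  ≲pullback B = record
    { to        = λ (y , y∈B) → proj₁ (from.to y) , proj₂ (from.to y) ,
                    respects B (Y.sym (Inverse.strictlyInverseˡ (Bijection⇒Inverse A≅Y) y)) y∈B
    ; cong      = from.cong
    ; injective = from.injective
    }

  pullback-∩≲ : (B C : Subset Y) → ⟦ pullback B ∩ pullback C ⟧ ≲ ⟦ B ∩ C ⟧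
  pullback-∩≲ B C = record
    -- The two pullbacks may carry different proofs of `x ∈ A`; congruence of `to` identifies the
    -- images.
    { to        = λ (x , (x∈A , fx∈B) , (x∈A′ , fx∈C)) →
                    to (x , x∈A) , fx∈B , respects C (cong (Setoid.refl X)) fx∈C
    ; cong      = cong
    ; injective = injective
    }

-- Finite sums of a sequence

module _ (S : Semigroup a a) (x : ℕ → Semigroup.Carrier S) where

  open Semigroup S

  FS : Subset setoid
  FS = record
    { pred     = λ s → Σ (List⁺ ℕ) λ H → Linked _<_ (toList H) × foldr₁ _∙_ (map x H) ≈ s
    ; respects = λ s≈t (H , lH , eq) → H , lH , trans eq s≈t
    }

  -- A sum is coded by its index set `H`. Different index sets may give equal sums, but one index
  -- set determines its sum.
  FS-countable : ExcludedMiddle a → ⟦ FS ⟧ ≲ ω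
  FS-countable em = reflecting⇒≲ω em ⟦ FS ⟧ code reflect
    where
    code : Setoid.Carrier ⟦ FS ⟧ → ℕ
    code (_ , H , _) = ℕᵇ.toℕ (listᵇ (toList H))

    reflect : ∀ s t → code s ≡ code t → Setoid._≈_ ⟦ FS ⟧ s t
    reflect (_ , H , _ , ΣH≈s) (_ , K , _ , ΣK≈t) eq
      with toList-injective (listᵇ-injective (toList H) (toList K) (ℕᵇ.toℕ-injective eq))
    ... | ≡.refl = trans (sym ΣH≈s) ΣK≈t

  IP-⊇FS : (A : Subset setoid) → FS ⊆ A → IsIP S A
  IP-⊇FS A FS⊆A = x , λ H lH → FS⊆A (H , lH , refl)

-- The family of almost disjoint IP sets

theorem2p8 : {a : Level} → ExcludedMiddle a →
    (S : Semigroup a a) (κ μ Λ : Setoid a a) →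
    ¬ HasIdempotent S →
    Semigroup.setoid S ≅ κ → ω ≺ κ →
    ω ≺ μ → μ ≲ κ →
    AlmostDisjointFamily Λ (full μ) →
    (A : Subset (Semigroup.setoid S)) → IsIP S A → ⟦ A ⟧ ≅ μ →
    ∃ λ (F : AlmostDisjointFamily Λ A) →
    ∀ i → IsIP S (AlmostDisjointFamily.member F i)
theorem2p8 em S κ μ Λ _ _ _ (ω≲μ , ω≇μ) _ 𝓑 A (x , FS∈A) A≅μ = 𝓒 , λ i → IP-⊇FS S x (C i) inj₂
  where
  open Semigroup S using (setoid)
  module 𝓑 = AlmostDisjointFamily 𝓑
  module Λ = Setoid Λ

  B : Λ.Carrier → Subset μ
  B = 𝓑.member

  D : Subset setoid
  D = FS S x

  B* C : Λ.Carrier → Subset setoid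
  B* i = pullback A A≅μ (B i)
  C i  = B* i ∪ D

  C⊆A : ∀ i → C i ⊆ A
  C⊆A i (inj₁ (s∈A , _))       = s∈A
  C⊆A i (inj₂ (H , lH , ΣH≈s)) = respects A ΣH≈s (FS∈A H lH)

  C≅A : ∀ i → ⟦ C i ⟧ ≅ ⟦ A ⟧
  C≅A i = ≲-antisym ⟦ C i ⟧ ⟦ A ⟧ (⊆⇒≲ (C i) A (C⊆A i))
    -- The chain of injections runs from `A` through `μ`, `full μ`, `B i` and `B* i` to `C i`.
    (≲.trans (≅⇒≲ A≅μ) (≲.trans ≲full (≲.trans (≅⇒≳ (𝓑.sameSize i))
      (≲.trans (≲pullback A A≅μ (B i)) (⊆⇒≲ (B* i) (C i) inj₁))))) em

  C∩C⊆ : ∀ i j → C i ∩ C j ⊆ (B* i ∩ B* j) ∪ D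
  C∩C⊆ i j (inj₁ s∈Bi , inj₁ s∈Bj) = inj₁ (s∈Bi , s∈Bj)
  C∩C⊆ i j (inj₁ _    , inj₂ s∈D)  = inj₂ s∈D
  C∩C⊆ i j (inj₂ s∈D  , _)         = inj₂ s∈D

  μ≴ω : ¬ (μ ≲ ω)
  μ≴ω μ≲ω = ω≇μ (≲-antisym ω μ ω≲μ μ≲ω em)

  -- Concluding with equality of `B i` and `B j` lets this serve both the injectivity and the almost
  -- disjointness of the new family.
  large⇒≐ : ∀ i j → ⟦ A ⟧ ≲ ⟦ C i ∩ C j ⟧ → Setoid._≈_ (𝒫 μ) (B i) (B j)
  large⇒≐ i j A≲ = decidable-stable em λ Bi≢Bj →
    let Bij = B* i ∩ B* j

        μ≲ : μ ≲ ⟦ Bij ∪ D ⟧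
        μ≲ = ≲.trans (≅⇒≳ A≅μ) (≲.trans A≲ (⊆⇒≲ (C i ∩ C j) (Bij ∪ D) (C∩C⊆ i j)))

        D≲ω : ⟦ D ⟧ ≲ ω
        D≲ω = FS-countable S x em

        ω≲Bij : ω ≲ ⟦ Bij ⟧
        ω≲Bij = uncountable⇒ω≲ em ⟦ Bij ⟧ λ Bij≲ω →
          μ≴ω (≲.trans μ≲ (∪-countable em Bij D Bij≲ω D≲ω))

        full≲ : ⟦ full μ ⟧ ≲ ⟦ B i ∩ B j ⟧
        full≲ = ≲.trans (⟦⟧≲ (full μ)) (≲.trans μ≲
          (≲.trans (∪-absorb em Bij D ω≲Bij D≲ω) (pullback-∩≲ A A≅μ (B i) (B j))))

        (≲full′ , ≇full) = 𝓑.almostDisjoint i j Bi≢Bj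
    in ≇full (≲-antisym ⟦ B i ∩ B j ⟧ ⟦ full μ ⟧ ≲full′ full≲ em)

  C-cong : ∀ i j → Setoid._≈_ (𝒫 μ) (B i) (B j) → Setoid._≈_ (𝒫 setoid) (C i) (C j)
  C-cong i j (Bi⊆Bj , Bj⊆Bi) = Sum.map₁ (map₂ Bi⊆Bj) , Sum.map₁ (map₂ Bj⊆Bi)

  𝓒 : AlmostDisjointFamily Λ A
  𝓒 = record
    { family = record
      { to        = C
      ; cong      = λ {i} {j} i≈j → C-cong i j (Injection.cong 𝓑.family i≈j)
      -- Adding `D` might have merged distinct sets. But if `C i` lies in `C j`, their intersection
      -- is all of `C i`, of the size of `A`, which forces `B i` and `B j` to agree.
      ; injective = λ {i} {j} (Ci⊆Cj , _) → Injection.injective 𝓑.family (large⇒≐ i j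
          (≲.trans (≅⇒≳ (C≅A i)) (⊆⇒≲ (C i) (C i ∩ C j) λ s∈Ci → s∈Ci , Ci⊆Cj s∈Ci)))
      }
    ; contained      = C⊆A
    ; sameSize       = C≅A
    ; almostDisjoint = λ i j Ci≢Cj →
        ⊆⇒≲ (C i ∩ C j) A (λ (s∈Ci , _) → C⊆A i s∈Ci) ,
        -- An intersection of full size makes `B i` and `B j` agree, and hence `C i` and `C j`.
        λ Cij≅A → Ci≢Cj (C-cong i j (large⇒≐ i j (≅⇒≳ Cij≅A)))
    }
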